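{- Let $n\ge2$ and let $\psi:\mathbb{F}_{2^n}\to\mathbb{F}_{2^n}$ be the inversion map $\psi(x)=x^{2^n-2}$ (i.e. $\psi(x)=x^{ -1}$ for $x\ne0$ and $\psi(0)=0$). Then for every $\rho\in\mathbb{F}_{2^n}\setminus\{0,1\}$, $$\bigl|\{\tau\in\mathbb{F}_{2^n}:\ \psi(\tau)+\psi(\tau+1)+\psi(\tau+\rho)=0\}\bigr|=1,$$ and consequently, for every $\rho\in\mathbb{F}_{2^n}\setminus\{0,1\}$, $$\sum_{t,a\in\mathbb{F}_{2^n}}\chi\bigl(\psi(t+\rho a)+\psi(t+a)+\psi(t)\bigr)=0.$$
   Context: $\mathbb{F}_{2^n}$ is the field with $2^n$ elements, $\operatorname{Tr}(x)=\sum_{i=0}^{n-1}x^{2^i}$ is the absolute trace, and $\chi(x)=(-1)^{\operatorname{Tr}(x)}$. -}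

module Defs where

open import Algebra.Apartness.Bundles using (HeytingCommutativeRing; HeytingField)
open import Algebra.Bundles using (CommutativeRing)
import Algebra.Properties.CommutativeMonoid.Sum as Sum
import Algebra.Properties.Semiring.Exp as Exp
open import Data.Bool.Base using (if_then_else_)
open import Data.Fin.Base using (Fin; toℕ)
open import Data.Fin.Properties using (inj⇒≟)
open import Data.Integer.Base as ℤ using (ℤ; -1ℤ)
import Data.Integer.Properties as ℤ
open import Data.List.Base using (List; length; filter; tabulate)
open import Data.Nat.Base as ℕ using (ℕ; _∸_)
open import Function.Bundles using (Inverse)
open import Function.Properties.Inverse using (Inverse⇒Injection)
open import Level using (_⊔_)
open import Relation.Binary.Bundles using (Setoid)
open import Relation.Binary.Definitions using (Decidable)
import Relation.Binary.PropositionalEquality.Properties as ≡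
open import Relation.Nullary.Decidable using (does)
open import Relation.Unary as Pred using (Pred)

ringOf : ∀ {c ℓ₁ ℓ₂} → HeytingField c ℓ₁ ℓ₂ → CommutativeRing c ℓ₁
ringOf F = HeytingCommutativeRing.commutativeRing (HeytingField.heytingCommutativeRing F)

HasCardinality : ∀ {c ℓ} → Setoid c ℓ → ℕ → Set (c ⊔ ℓ)
HasCardinality S q = Inverse S (≡.setoid (Fin q))

-- A Heyting field with finitely many elements is a field in the usual sense:
-- its equality is decidable, so by tightness and a finite search every x ≉ 0#
-- is invertible, and 0# ≉ 1#.  Characteristic 2 follows from the cardinality.
module BinaryField
  {c ℓ₁ ℓ₂} (n : ℕ) (F : HeytingField c ℓ₁ ℓ₂)
  (card : HasCardinality (CommutativeRing.setoid (ringOf F)) (2 ℕ.^ n))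
  where

  open CommutativeRing (ringOf F) public
    using (Carrier; _≈_; _≉_; _+_; _*_; 0#; 1#)
  open CommutativeRing (ringOf F)
    using (semiring; +-commutativeMonoid)
  open Exp semiring using (_^_)

  _≟_ : Decidable _≈_
  _≟_ = inj⇒≟ (Inverse⇒Injection card)

  element : Fin (2 ℕ.^ n) → Carrier
  element = Inverse.from card

  elements : List Carrier
  elements = tabulate element

  ∣_∣ : ∀ {p} {P : Pred Carrier p} → Pred.Decidable P → ℕ
  ∣ P? ∣ = length (filter P? elements)

  ∑ : (Carrier → ℤ) → ℤ
  ∑ f = sum (λ i → f (element i))
    where open Sum ℤ.+-0-commutativeMonoid using (sum)

  Tr : Carrier → Carrier
  Tr x = sum {n} (λ i → x ^ (2 ℕ.^ toℕ i))
    where open Sum +-commutativeMonoid using (sum)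

  -- The exponent of -1 named by an element of the prime subfield {0#, 1#};
  -- Tr only takes values there, so the value on other elements is irrelevant.
  exponent : Carrier → ℕ
  exponent y = if does (y ≟ 0#) then 0 else 1

  χ : Carrier → ℤ
  χ x = -1ℤ ℤ.^ exponent (Tr x)

  ψ : Carrier → Carrier
  ψ x = x ^ (2 ℕ.^ n ∸ 2)

{-# OPTIONS --safe #-}
module Submission where

-- For τ outside {0, 1, ρ}, clearing denominators in 1/τ + 1/(τ+1) + 1/(τ+ρ)
-- leaves τ² + ρ in characteristic 2, so the only root is the square root of ρ;
-- none of 0, 1, ρ is a root because ψ is injective.
--
-- For a ≠ 0 the substitution t = aτ turns the summand into χ(ψ(a) g(τ)), where
-- g(τ) = ψ(τ) + ψ(τ+1) + ψ(τ+ρ).  Summing χ(ψ(a) g(τ)) over all a and τ, only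
-- the root of g contributes, giving q.  This is exactly the contribution of
-- a = 0, for which the original inner sum Σ_t χ(ψ(t)) vanishes.

open import Defs
open import Algebra.Apartness.Bundles using (HeytingField)
open import Algebra.Bundles using (AbelianGroup; CommutativeMonoid; CommutativeRing)
open import Algebra.Definitions using (Congruent₁)
open import Algebra.Solver.Ring.AlmostCommutativeRing using (_-Raw-AlmostCommutative⟶_; Induced-equivalence; fromCommutativeSemiring)
import Algebra.Apartness.Properties.HeytingCommutativeRing as HeytingProperties
import Algebra.Properties.CommutativeMonoid.Sum as Sum
import Algebra.Properties.CommutativeSemiring.Exp as Exp
import Algebra.Properties.Group as GroupProperties
import Algebra.Properties.Ring as RingProperties
import Algebra.Properties.Semiring.Mult as Mult
import Algebra.Solver.Ring as RingSolver
import Algebra.Solver.Ring.NaturalCoefficients.Default as SemiringSolver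
open import Data.Bool.Base using (Bool; true; false; if_then_else_)
import Data.Bool.Properties as Bool
open import Data.Fin.Base using (Fin; zero; suc; punchIn; toℕ)
open import Data.Fin.Permutation using (Permutation′; permutation)
open import Data.Fin.Properties as Fin using (punchInᵢ≢i; any?)
open import Data.Integer.Base as ℤ using (ℤ; 0ℤ; 1ℤ; -1ℤ; +_)
import Data.Integer.Properties as ℤ
open import Data.List.Base using (List; []; _∷_; length; filter; tabulate)
open import Data.List.Properties using (filter-accept; filter-none; filter-reject)
open import Data.List.Relation.Unary.All.Properties using (tabulate⁺)
open import Data.Nat.Base as ℕ using (ℕ; zero; suc; _≤_; _<_; _^_; _∸_; z≤n; s≤s)
import Data.Nat.Properties as ℕ
open import Data.Product.Base using (_×_; _,_; ∃; proj₁; proj₂)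
open import Function.Base using (_∘_)
open import Function.Bundles using (Inverse)
open import Level using (Level)
open import Relation.Binary.Consequences using (dec⇒weaklyDec)
open import Relation.Binary.Definitions using (Decidable)
open import Relation.Binary.PropositionalEquality as ≡ using (_≡_; _≢_; cong; cong₂; module ≡-Reasoning)
import Relation.Binary.Reasoning.Setoid as SetoidReasoning
open import Relation.Nullary using (¬_; does; yes; no; contradiction)
open import Relation.Nullary.Decidable as Dec using (¬?; decidable-stable; dec-true; dec-false)
open import Relation.Unary as Pred using (Pred)

-- Sums over finite index sets, and counting a unique solution.

module _ {c ℓ} (M : CommutativeMonoid c ℓ) where
  open CommutativeMonoid M
  open Sum M

  -- Both sides are `f i ∙ g i` times the common rest. A monoid has no subtraction, so the terms at
  -- `i` are exchanged across the equation. Used multiplicatively for Fermat's identity and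
  -- additively to compare two integer sums.
  sum-differ-at : ∀ {n} (f g : Fin n → Carrier) (i : Fin n) →
    (∀ j → j ≢ i → f j ≈ g j) → g i ∙ sum f ≈ f i ∙ sum g
  sum-differ-at {suc n} f g i f≈g = begin
    g i ∙ sum f                       ≈⟨ ∙-congˡ (sum-remove f) ⟩
    g i ∙ (f i ∙ sum (f ∘ punchIn i)) ≈⟨ assoc _ _ _ ⟨
    (g i ∙ f i) ∙ sum (f ∘ punchIn i) ≈⟨ ∙-cong (comm _ _)
                                           (sum-cong-≋ (λ j → f≈g _ (punchInᵢ≢i i j))) ⟩
    (f i ∙ g i) ∙ sum (g ∘ punchIn i) ≈⟨ assoc _ _ _ ⟩
    f i ∙ (g i ∙ sum (g ∘ punchIn i)) ≈⟨ ∙-congˡ (sum-remove g) ⟨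
    f i ∙ sum g                       ∎
    where open SetoidReasoning setoid

  sum-single : ∀ {n} (f : Fin n → Carrier) (i : Fin n) →
    (∀ j → j ≢ i → f j ≈ ε) → sum f ≈ f i
  sum-single {n} f i f≈ε = begin
    sum f                   ≈⟨ identityˡ _ ⟨
    ε ∙ sum f               ≈⟨ sum-differ-at f (λ _ → ε) i f≈ε ⟩
    f i ∙ sum {n} (λ _ → ε) ≈⟨ ∙-congˡ (sum-replicate-zero n) ⟩
    f i ∙ ε                 ≈⟨ identityʳ _ ⟩
    f i                     ∎
    where open SetoidReasoning setoid

length-filter-unique : ∀ {a p} {A : Set a} {P : Pred A p} (P? : Pred.Decidable P) →
  ∀ {n} (f : Fin n → A) (i : Fin n) → P (f i) → (∀ j → P (f j) → j ≡ i) →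
  length (filter P? (tabulate f)) ≡ 1
length-filter-unique P? {suc n} f zero Pf₀ uniq =
  ≡.trans (cong length (filter-accept P? Pf₀))
    (cong (suc ∘ length) (filter-none P? (tabulate⁺ (λ j Pj → Fin.0≢1+n (≡.sym (uniq (suc j) Pj))))))
length-filter-unique P? {suc n} f (suc i) Pfᵢ uniq =
  ≡.trans (cong length (filter-reject P? (λ P₀ → Fin.0≢1+n (uniq zero P₀))))
    (length-filter-unique P? (f ∘ suc) i Pfᵢ (λ j Pj → Fin.suc-injective (uniq (suc j) Pj)))

i+i≡0⇒i≡0 : ∀ i → i ℤ.+ i ≡ 0ℤ → i ≡ 0ℤ
-- For a positive or a negative `i` the double computes to a nonzero constructor form, so the
-- hypothesis is absurd.
i+i≡0⇒i≡0 (+ 0) _ = ≡.refl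

-- Monic polynomials and the bound on their number of roots.

module MonicPolynomial {c ℓ} (R : CommutativeRing c ℓ) where
  open CommutativeRing R hiding (zero)
  open SemiringSolver commutativeSemiring using (solve; _:+_; _:*_; _:=_)
  open RingProperties ring using (+-cancelˡ)
  open SetoidReasoning setoid

  -- The leading coefficient 1# of the monic polynomial is not listed, so that
  -- its degree is the length of the list.
  eval : List Carrier → Carrier → Carrier
  eval []       x = 1#
  eval (a ∷ as) x = a + x * eval as x

  -- Synthetic division: the quotient of a + x f(x) by x - r does not depend on a, and its
  -- coefficients are the values at r of the successive tails of f. The last tail, of value `1#`,
  -- becomes the implicit leading coefficient.
  quotient : Carrier → List Carrier → List Carrier
  quotient r []       = []
  quotient r (a ∷ as) = eval (a ∷ as) r ∷ quotient r as

  length-quotient : ∀ r as → length (quotient r as) ≡ length as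
  length-quotient r []       = ≡.refl
  length-quotient r (a ∷ as) = cong suc (length-quotient r as)

  -- f(x) - f(r) = (x - r) q(x), without subtraction.
  eval-quotient : ∀ r a as x →
    eval (a ∷ as) x + r * eval (quotient r as) x ≈ eval (a ∷ as) r + x * eval (quotient r as) x
  eval-quotient r a []        x =
    solve 4 (λ a x r e → (a :+ x :* e) :+ r :* e := (a :+ r :* e) :+ x :* e) refl a x r 1#
  eval-quotient r a (b ∷ as) x = begin
    (a + x * fx) + r * (fr + x * q) ≈⟨ solve 6 (λ a x fx r fr q →
         (a :+ x :* fx) :+ r :* (fr :+ x :* q) := (a :+ r :* fr) :+ x :* (fx :+ r :* q)) refl a x fx r fr q ⟩
    (a + r * fr) + x * (fx + r * q) ≈⟨ +-congˡ (*-congˡ (eval-quotient r b as x)) ⟩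
    (a + r * fr) + x * (fr + x * q) ∎
    where
    fx = eval (b ∷ as) x
    fr = eval (b ∷ as) r
    q  = eval (quotient r as) x

  -- Induction by splitting off the first root: the remaining ones are distinct from it, so they are
  -- roots of the quotient. The second hypothesis is the absence of zero divisors, phrased without
  -- subtraction.
  roots≤degree : 1# ≉ 0# → (∀ {x y z} → x ≉ y → x * z ≈ y * z → z ≈ 0#) →
    ∀ {k} as (r : Fin k → Carrier) → (∀ {i j} → r i ≈ r j → i ≡ j) →
    (∀ i → eval as (r i) ≈ 0#) → k ≤ length as
  roots≤degree 1≉0 cancel {zero}  as       r inj root = z≤n
  roots≤degree 1≉0 cancel {suc k} []       r inj root = contradiction (root zero) 1≉0
  roots≤degree 1≉0 cancel {suc k} (a ∷ as) r inj root =
    s≤s (≡.subst (k ≤_) (length-quotient r₀ as)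
      (roots≤degree 1≉0 cancel (quotient r₀ as) (r ∘ suc) (Fin.suc-injective ∘ inj)
        (λ i → cancel (λ r₀≈rᵢ → Fin.0≢1+n (inj r₀≈rᵢ)) (vanish i))))
    where
    r₀ = r zero
    vanish : ∀ i → r₀ * eval (quotient r₀ as) (r (suc i)) ≈ r (suc i) * eval (quotient r₀ as) (r (suc i))
    vanish i = +-cancelˡ 0# _ _ (begin
      0# + r₀ * q                  ≈⟨ +-congʳ (root (suc i)) ⟨
      eval (a ∷ as) rᵢ + r₀ * q    ≈⟨ eval-quotient r₀ a as rᵢ ⟩
      eval (a ∷ as) r₀ + rᵢ * q    ≈⟨ +-congʳ (root zero) ⟩
      0# + rᵢ * q                  ∎)
      where
      rᵢ = r (suc i)
      q = eval (quotient r₀ as) rᵢ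

  -- The polynomial f(x^2). Each zero follows a listed coefficient, so the implicit leading `1#`
  -- moves to twice the degree.
  substSquare : List Carrier → List Carrier
  substSquare []       = []
  substSquare (a ∷ as) = a ∷ 0# ∷ substSquare as

  eval-substSquare : ∀ as x → eval (substSquare as) x ≈ eval as (x * x)
  eval-substSquare []       x = refl
  eval-substSquare (a ∷ as) x = +-congˡ (begin
    x * (0# + x * eval (substSquare as) x) ≈⟨ *-congˡ (+-identityˡ _) ⟩
    x * (x * eval (substSquare as) x)      ≈⟨ *-assoc x x _ ⟨
    x * x * eval (substSquare as) x        ≈⟨ *-congˡ (eval-substSquare as x) ⟩
    x * x * eval as (x * x)                ∎)

  length-substSquare : ∀ as → length (substSquare as) ≡ length as ℕ.* 2
  length-substSquare []       = ≡.refl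
  length-substSquare (a ∷ as) = cong (2 ℕ.+_) (length-substSquare as)

-- Sums x + x^2 + x^4 + ... in a commutative ring.

module Trace {c ℓ} (R : CommutativeRing c ℓ) where
  open CommutativeRing R hiding (zero)
  open Exp commutativeSemiring using (^-congˡ; ^-assocʳ) renaming (_^_ to _^ᴿ_)
  open Sum +-commutativeMonoid using (sum; sum-cong-≋)
  open MonicPolynomial R
  open SemiringSolver commutativeSemiring using (solve; _:+_; _:*_; _:=_)
  open SetoidReasoning setoid

  trace : ℕ → Carrier → Carrier
  trace m x = sum {m} (λ i → x ^ᴿ (2 ^ toℕ i))

  trace-cong : ∀ m {x y} → x ≈ y → trace m x ≈ trace m y
  trace-cong m x≈y = sum-cong-≋ {m} (λ i → ^-congˡ (2 ^ toℕ i) x≈y)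

  square-^ : ∀ x k → x ^ᴿ (2 ℕ.* k) ≈ (x * x) ^ᴿ k
  square-^ x k = begin
    x ^ᴿ (2 ℕ.* k) ≈⟨ ^-assocʳ x 2 k ⟨
    (x ^ᴿ 2) ^ᴿ k  ≈⟨ ^-congˡ k (*-congˡ (*-identityʳ x)) ⟩
    (x * x) ^ᴿ k   ∎

  trace-suc : ∀ m x → trace (suc m) x ≈ x + trace m (x * x)
  trace-suc m x = +-cong (*-identityʳ x) (sum-cong-≋ {m} (λ i → square-^ x (2 ^ toℕ i)))

  -- Counterpart of `trace-suc`, which splits off the first term instead. Comparing the two gives
  -- invariance of the trace under squaring once x^(2^n) = x is known.
  trace-last : ∀ m x → trace (suc m) x ≈ trace m x + x ^ᴿ (2 ^ m)
  trace-last zero    x = +-comm _ _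
  trace-last (suc m) x = begin
    trace (2 ℕ.+ m) x                               ≈⟨ trace-suc (suc m) x ⟩
    x + trace (suc m) (x * x)                       ≈⟨ +-congˡ (trace-last m (x * x)) ⟩
    x + (trace m (x * x) + (x * x) ^ᴿ (2 ^ m))      ≈⟨ +-assoc _ _ _ ⟨
    (x + trace m (x * x)) + (x * x) ^ᴿ (2 ^ m)      ≈⟨ +-cong (trace-suc m x) (square-^ x (2 ^ m)) ⟨
    trace (suc m) x + x ^ᴿ (2 ^ suc m)              ∎

  -- Built by the recursion T(x) -> x + T(x^2). The index is `suc m` because the empty trace is the
  -- zero polynomial, which is not monic.
  tracePolynomial : ∀ m → ∃ λ as → length as ≡ 2 ^ m × (∀ x → eval as x ≈ trace (suc m) x)
  tracePolynomial zero    = 0# ∷ [] , ≡.refl , λ x → +-comm 0# (x * 1#)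
  tracePolynomial (suc m) with tracePolynomial m
  ... | []     , |as|≡ , _   = contradiction |as|≡ (ℕ.<⇒≢ (ℕ.m^n>0 2 m))
  -- This is `substSquare (a ∷ as)` with its linear coefficient `0#` raised to `1#`, which adds the
  -- term x.
  ... | a ∷ as , |as|≡ , as≈ = a ∷ 1# ∷ substSquare as
      , ≡.trans (length-substSquare (a ∷ as)) (≡.trans (cong (ℕ._* 2) |as|≡) (ℕ.*-comm (2 ^ m) 2))
      , λ x → begin
          a + x * (1# + x * eval (substSquare as) x) ≈⟨ +-congˡ (*-congˡ (+-congˡ (*-congˡ (eval-substSquare as x)))) ⟩
          a + x * (1# + x * eval as (x * x))         ≈⟨ solve 4 (λ a x e f →
             a :+ x :* (e :+ x :* f) := x :* e :+ (a :+ (x :* x) :* f)) refl a x 1# (eval as (x * x)) ⟩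
          x * 1# + (a + x * x * eval as (x * x))     ≈⟨ +-cong (*-identityʳ x) (as≈ (x * x)) ⟩
          x + trace (suc m) (x * x)                  ≈⟨ trace-suc (suc m) x ⟨
          trace (2 ℕ.+ m) x                          ∎

  trace-+ : (∀ x y → (x + y) * (x + y) ≈ x * x + y * y) →
    ∀ m x y → trace m (x + y) ≈ trace m x + trace m y
  trace-+ sq zero    x y = sym (+-identityˡ 0#)
  trace-+ sq (suc m) x y = begin
    trace (suc m) (x + y)                               ≈⟨ trace-suc m (x + y) ⟩
    (x + y) + trace m ((x + y) * (x + y))               ≈⟨ +-congˡ (trace-cong m (sq x y)) ⟩
    (x + y) + trace m (x * x + y * y)                   ≈⟨ +-congˡ (trace-+ sq m (x * x) (y * y)) ⟩
    (x + y) + (trace m (x * x) + trace m (y * y))       ≈⟨ solve 4 (λ x y a b →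
             (x :+ y) :+ (a :+ b) := (x :+ a) :+ (y :+ b)) refl x y _ _ ⟩
    (x + trace m (x * x)) + (y + trace m (y * y))       ≈⟨ +-cong (trace-suc m x) (trace-suc m y) ⟨
    trace (suc m) x + trace (suc m) y                   ∎

  -- Squaring is additive by hypothesis, so it passes through the sum term by term.
  trace-square : (∀ x y → (x + y) * (x + y) ≈ x * x + y * y) →
    ∀ m x → trace m (x * x) ≈ trace m x * trace m x
  trace-square sq zero    x = sym (zeroˡ 0#)
  trace-square sq (suc m) x = begin
    trace (suc m) (x * x)                         ≈⟨ trace-suc m (x * x) ⟩
    x * x + trace m (x * x * (x * x))             ≈⟨ +-congˡ (trace-square sq m (x * x)) ⟩
    x * x + trace m (x * x) * trace m (x * x)     ≈⟨ sq _ _ ⟨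
    (x + trace m (x * x)) * (x + trace m (x * x)) ≈⟨ *-cong (trace-suc m x) (trace-suc m x) ⟨
    trace (suc m) x * trace (suc m) x             ∎

module FiniteField {c ℓ₁ ℓ₂} (n : ℕ) (2≤n : 2 ≤ n) (F : HeytingField c ℓ₁ ℓ₂)
  (card : HasCardinality (CommutativeRing.setoid (ringOf F)) (2 ^ n)) where

  open BinaryField n F card
  R : CommutativeRing c ℓ₁
  R = ringOf F
  open CommutativeRing R hiding (Carrier; _≈_; _≉_; _+_; _*_; 0#; 1#; zero)
  open HeytingProperties (HeytingField.heytingCommutativeRing F) using (1#0; x-0≈x)
  open RingProperties ring using (+-cancelˡ)
  open Exp commutativeSemiring using (^-congˡ; ^-homo-*; ^-distrib-*) renaming (_^_ to _^ᴿ_)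
  open MonicPolynomial R using (eval; roots≤degree)
  open Trace R
  open SetoidReasoning setoid

  index : Carrier → Fin (2 ^ n)
  index = Inverse.to card

  index-cong : ∀ {x y} → x ≈ y → index x ≡ index y
  index-cong = Inverse.to-cong card

  element-index : ∀ x → element (index x) ≈ x
  element-index = Inverse.strictlyInverseʳ card

  index-element : ∀ i → index (element i) ≡ i
  index-element = Inverse.strictlyInverseˡ card

  index-unique : ∀ {x i} → element i ≈ x → i ≡ index x
  index-unique eq = ≡.trans (≡.sym (index-element _)) (index-cong eq)

  module _ {a b} (M : CommutativeMonoid a b) where
    private
      module M = CommutativeMonoid M
    open Sum M

    -- The bijection `f` with inverse `g` is transported to a permutation of the indices. The monoid
    -- is arbitrary so that products and sums in the field and sums of integers are all covered.
    sum-reindex : (h : Carrier → M.Carrier) → (∀ {x y} → x ≈ y → h x M.≈ h y) →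
      (f g : Carrier → Carrier) → Congruent₁ _≈_ f → Congruent₁ _≈_ g →
      (∀ x → f (g x) ≈ x) → (∀ x → g (f x) ≈ x) →
      sum (λ i → h (element i)) M.≈ sum (λ i → h (f (element i)))
    sum-reindex h h-cong f g f-cong g-cong fg gf = M.trans
      (sum-permute (h ∘ element) π)
      (sum-cong-≋ {2 ^ n} (λ i → h-cong (element-index (f (element i)))))
      where
      π : Permutation′ (2 ^ n)
      π = permutation (index ∘ f ∘ element) (index ∘ g ∘ element)
        (λ i → ≡.trans (index-cong (trans (f-cong (element-index _)) (fg _))) (index-element i))
        (λ i → ≡.trans (index-cong (trans (g-cong (element-index _)) (gf _))) (index-element i))

  1≉0 : 1# ≉ 0#
  1≉0 1≈0 = proj₂ (HeytingField.tight F 1# 0#) 1≈0 1#0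

  -- Search all elements. If none is an inverse, x cannot be apart from `0#`, since apartness would
  -- supply one, and tightness then yields `x ≈ 0#`.
  inverse : ∀ {x} → x ≉ 0# → ∃ λ y → x * y ≈ 1#
  inverse {x} x≉0 with any? (λ i → (x * element i) ≟ 1#)
  ... | yes (i , eq) = element i , eq
  ... | no  none     = contradiction (proj₁ (HeytingField.tight F x 0#) ¬x#0) x≉0
    where
    ¬x#0 : ¬ HeytingField._#_ F x 0#
    ¬x#0 x#0 with HeytingField.#⇒invertible F x#0
    ... | y , _ , x-0*y≈1 = none (index y , (begin
      x * element (index y) ≈⟨ *-cong (sym (x-0≈x x)) (element-index y) ⟩
      (x - 0#) * y          ≈⟨ x-0*y≈1 ⟩
      1#                    ∎))

  inverse-undoˡ : ∀ {x y} → x * y ≈ 1# → ∀ z → x * (y * z) ≈ z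
  inverse-undoˡ xy≈1 z = trans (sym (*-assoc _ _ z)) (trans (*-congʳ xy≈1) (*-identityˡ z))

  inverse-undoʳ : ∀ {x y} → x * y ≈ 1# → ∀ z → z * x * y ≈ z
  inverse-undoʳ xy≈1 z = trans (*-assoc z _ _) (trans (*-congˡ xy≈1) (*-identityʳ z))

  *-cancelˡ : ∀ {x y z} → x ≉ 0# → x * y ≈ x * z → y ≈ z
  *-cancelˡ {x} {y} {z} x≉0 xy≈xz with inverse x≉0
  ... | x⁻¹ , xx⁻¹≈1 = trans (sym (inverse-undoˡ x⁻¹x≈1 y)) (trans (*-congˡ xy≈xz) (inverse-undoˡ x⁻¹x≈1 z))
    where
    x⁻¹x≈1 : x⁻¹ * x ≈ 1#
    x⁻¹x≈1 = trans (*-comm x⁻¹ x) xx⁻¹≈1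

  *-nonzero : ∀ {x y} → x ≉ 0# → y ≉ 0# → x * y ≉ 0#
  *-nonzero x≉0 y≉0 xy≈0 = y≉0 (*-cancelˡ x≉0 (trans xy≈0 (sym (zeroʳ _))))

  -- Fermat's identity x^(2^n) = x.

  orOne : Carrier → Carrier → Carrier
  orOne x y = if does (x ≟ 0#) then 1# else y

  orOne-zero : ∀ {x} y → x ≈ 0# → orOne x y ≡ 1#
  orOne-zero {x} y x≈0 rewrite dec-true (x ≟ 0#) x≈0 = ≡.refl

  orOne-nonzero : ∀ {x} y → x ≉ 0# → orOne x y ≡ y
  orOne-nonzero {x} y x≉0 rewrite dec-false (x ≟ 0#) x≉0 = ≡.refl

  open Sum *-commutativeMonoid using () renaming
    (sum to product; sum-cong-≋ to product-cong; ∑-distrib-+ to product-distrib; sum-replicate to product-replicate)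

  product-nonzero : ∀ {m} (f : Fin m → Carrier) → (∀ i → f i ≉ 0#) → product f ≉ 0#
  product-nonzero {zero}  f f≉0 = 1≉0
  product-nonzero {suc m} f f≉0 = *-nonzero (f≉0 zero) (product-nonzero (f ∘ suc) (f≉0 ∘ suc))

  -- Multiplication by y permutes the nonzero elements, whose product therefore
  -- equals itself times y^(q-1); orOne replaces the factors at zero by 1.
  fermat-nonzero : ∀ {y} → y ≉ 0# → y ^ᴿ (2 ^ n) ≈ y
  fermat-nonzero {y} y≉0 = begin
    y ^ᴿ (2 ^ n)                               ≈⟨ product-replicate (2 ^ n) ⟨
    product {2 ^ n} (λ _ → y)                  ≈⟨ *-identityˡ _ ⟨
    1# * product {2 ^ n} (λ _ → y)             ≈⟨ *-congʳ (reflexive (orOne-zero y (element-index 0#))) ⟨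
    scale i₀ * product {2 ^ n} (λ _ → y)       ≈⟨ sum-differ-at *-commutativeMonoid scale (λ _ → y) i₀
                                                    (λ j j≢i₀ → reflexive (orOne-nonzero y (j≢i₀ ∘ index-unique))) ⟨
    y * product scale                          ≈⟨ *-congˡ product-scale ⟩
    y * 1#                                     ≈⟨ *-identityʳ y ⟩
    y                                          ∎
    where
    i₀ : Fin (2 ^ n)
    i₀ = index 0#
    scale : Fin (2 ^ n) → Carrier
    scale i = orOne (element i) y
    unit : Carrier → Carrier
    unit x = orOne x x
    unit-cong : ∀ {x x′} → x ≈ x′ → unit x ≈ unit x′
    unit-cong {x} {x′} x≈x′ with x ≟ 0# | x′ ≟ 0#
    ... | yes x≈0 | yes x′≈0 = reflexive (≡.trans (orOne-zero x x≈0) (≡.sym (orOne-zero x′ x′≈0)))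
    ... | no  x≉0 | no  x′≉0 = trans (reflexive (orOne-nonzero x x≉0))
                                 (trans x≈x′ (reflexive (≡.sym (orOne-nonzero x′ x′≉0))))
    ... | yes x≈0 | no  x′≉0 = contradiction (trans (sym x≈x′) x≈0) x′≉0
    ... | no  x≉0 | yes x′≈0 = contradiction (trans x≈x′ x′≈0) x≉0
    unit-nonzero : ∀ x → unit x ≉ 0#
    unit-nonzero x with x ≟ 0#
    ... | yes x≈0 = 1≉0 ∘ trans (reflexive (≡.sym (orOne-zero x x≈0)))
    ... | no  x≉0 = x≉0 ∘ trans (reflexive (≡.sym (orOne-nonzero x x≉0)))
    unit-* : ∀ x → unit (y * x) ≈ orOne x y * unit x
    unit-* x with x ≟ 0#
    ... | yes x≈0 = begin
      unit (y * x)       ≡⟨ orOne-zero _ (trans (*-congˡ x≈0) (zeroʳ y)) ⟩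
      1#                 ≈⟨ *-identityˡ 1# ⟨
      1# * 1#            ≡⟨ cong₂ _*_ (orOne-zero y x≈0) (orOne-zero x x≈0) ⟨
      orOne x y * unit x ∎
    ... | no  x≉0 = begin
      unit (y * x)       ≡⟨ orOne-nonzero _ (*-nonzero y≉0 x≉0) ⟩
      y * x              ≡⟨ cong₂ _*_ (orOne-nonzero y x≉0) (orOne-nonzero x x≉0) ⟨
      orOne x y * unit x ∎
    y⁻¹ : Carrier
    y⁻¹ = proj₁ (inverse y≉0)
    yy⁻¹≈1 : y * y⁻¹ ≈ 1#
    yy⁻¹≈1 = proj₂ (inverse y≉0)
    ∏units : Carrier
    ∏units = product (unit ∘ element)
    product-scale : product scale ≈ 1#
    product-scale = *-cancelˡ (product-nonzero (unit ∘ element) (unit-nonzero ∘ element)) (begin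
      ∏units * product scale                       ≈⟨ *-comm _ _ ⟩
      product scale * ∏units                       ≈⟨ product-distrib scale (unit ∘ element) ⟨
      product (λ i → scale i * unit (element i))   ≈⟨ product-cong (λ i → unit-* (element i)) ⟨
      product (λ i → unit (y * element i))         ≈⟨ sum-reindex *-commutativeMonoid unit unit-cong
                                                        (y *_) (y⁻¹ *_) *-congˡ *-congˡ
                                                        (inverse-undoˡ yy⁻¹≈1)
                                                        (inverse-undoˡ (trans (*-comm _ _) yy⁻¹≈1)) ⟨
      ∏units                                       ≈⟨ *-identityʳ _ ⟨
      ∏units * 1#                                  ∎)

  x≈0⇒x^k≈0 : ∀ {x k} → 0 < k → x ≈ 0# → x ^ᴿ k ≈ 0#
  x≈0⇒x^k≈0 {k = suc k} _ x≈0 = trans (*-congʳ x≈0) (zeroˡ _)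

  fermat : ∀ x → x ^ᴿ (2 ^ n) ≈ x
  fermat x with x ≟ 0#
  ... | yes x≈0 = trans (x≈0⇒x^k≈0 (ℕ.m^n>0 2 n) x≈0) (sym x≈0)
  ... | no  x≉0 = fermat-nonzero x≉0

  -- Characteristic 2.

  -- Translation by `1#` permutes the field, so the sum S of all elements equals S + 2^n·1 and 2^n·1
  -- vanishes. This multiple is the n-th power of 1 + 1, and there are no zero divisors.
  characteristic2 : 1# + 1# ≈ 0#
  characteristic2 = decidable-stable (_ ≟ _) (λ 2≉0 → 2^k×1≉0 2≉0 n q×1≈0)
    where
    open Mult semiring using (×1-homo-*) renaming (_×_ to _×ᴿ_)
    open Sum +-commutativeMonoid using (sum; ∑-distrib-+; sum-replicate)
    S : Carrier
    S = sum element
    q×1≈0 : (2 ^ n) ×ᴿ 1# ≈ 0#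
    q×1≈0 = +-cancelˡ S _ _ (begin
      S + (2 ^ n) ×ᴿ 1#             ≈⟨ +-congˡ (sum-replicate (2 ^ n)) ⟨
      S + sum {2 ^ n} (λ _ → 1#)    ≈⟨ ∑-distrib-+ element (λ _ → 1#) ⟨
      sum (λ i → element i + 1#)    ≈⟨ sum-reindex +-commutativeMonoid (λ x → x) (λ x≈y → x≈y)
                                         (_+ 1#) (_- 1#) +-congʳ +-congʳ
                                         (λ x → trans (+-assoc x _ _) (trans (+-congˡ (-‿inverseˡ 1#)) (+-identityʳ x)))
                                         (λ x → trans (+-assoc x _ _) (trans (+-congˡ (-‿inverseʳ 1#)) (+-identityʳ x))) ⟨
      S                             ≈⟨ +-identityʳ S ⟨
      S + 0#                        ∎)
    2^k×1≉0 : 1# + 1# ≉ 0# → ∀ k → (2 ^ k) ×ᴿ 1# ≉ 0#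
    2^k×1≉0 2≉0 zero    eq = 1≉0 (trans (sym (+-identityʳ 1#)) eq)
    2^k×1≉0 2≉0 (suc k) eq = *-nonzero (2≉0 ∘ trans (+-congˡ (sym (+-identityʳ 1#)))) (2^k×1≉0 2≉0 k)
      (trans (sym (×1-homo-* 2 (2 ^ k))) eq)

  bit : Bool → Carrier
  bit b = if b then 1# else 0#

  bit-injective : ∀ {a b} → bit a ≈ bit b → a ≡ b
  bit-injective {false} {false} _   = ≡.refl
  bit-injective {true}  {true}  _   = ≡.refl
  bit-injective {true}  {false} 1≈0 = contradiction 1≈0 1≉0
  bit-injective {false} {true}  0≈1 = contradiction (sym 0≈1) 1≉0

  bit-homomorphism : CommutativeRing.rawRing Bool.xor-∧-commutativeRing
    -Raw-AlmostCommutative⟶ fromCommutativeSemiring commutativeSemiring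
  bit-homomorphism = record
    { ⟦_⟧    = bit
    ; +-homo = λ { false b → sym (+-identityˡ _) ; true false → sym (+-identityʳ _) ; true true → sym characteristic2 }
    ; *-homo = λ { false b → sym (zeroˡ _) ; true b → sym (*-identityˡ _) }
    ; -‿homo = λ _ → refl
    ; 0-homo = refl
    ; 1-homo = refl
    }

  _bit≟_ : Decidable (Induced-equivalence bit-homomorphism)
  a bit≟ b = Dec.map′ (λ a≡b → reflexive (cong bit a≡b)) bit-injective (a Bool.≟ b)

  -- In characteristic 2 negation is the identity, so that a ring solver with
  -- coefficients in Bool, seen as the field with two elements, applies.
  module Char2 = RingSolver
    (CommutativeRing.rawRing Bool.xor-∧-commutativeRing)
    (fromCommutativeSemiring commutativeSemiring)
    bit-homomorphism
    (dec⇒weaklyDec _bit≟_)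

  open Char2 using (solve; con; _:+_; _:*_; _:=_)

  x+y≈0⇒x≈y : ∀ {x y} → x + y ≈ 0# → x ≈ y
  x+y≈0⇒x≈y {x} {y} x+y≈0 = begin
    x           ≈⟨ solve 2 (λ x y → x := (x :+ y) :+ y) refl x y ⟩
    (x + y) + y ≈⟨ +-congʳ x+y≈0 ⟩
    0# + y      ≈⟨ +-identityˡ y ⟩
    y           ∎

  x≈y⇒x+y≈0 : ∀ {x y} → x ≈ y → x + y ≈ 0#
  x≈y⇒x+y≈0 {x} {y} x≈y = trans (+-congʳ x≈y) (solve 1 (λ y → y :+ y := con false) refl y)

  square-+ : ∀ x y → (x + y) * (x + y) ≈ x * x + y * y
  square-+ = solve 2 (λ x y → (x :+ y) :* (x :+ y) := x :* x :+ y :* y) refl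

  -- The sum of the two squares is (x + y)^2, and a nonzero element has a nonzero square.
  square-injective : ∀ {x y} → x * x ≈ y * y → x ≈ y
  square-injective {x} {y} xx≈yy = x+y≈0⇒x≈y (decidable-stable (_ ≟ _) (λ x+y≉0 →
    *-nonzero x+y≉0 x+y≉0 (trans (square-+ x y) (x≈y⇒x+y≈0 xx≈yy))))

  square-surjective : ∀ y → ∃ λ x → x * x ≈ y
  -- Squaring this witness gives y^(2^n), which is y by `fermat`.
  square-surjective y = y ^ᴿ (2 ^ (n ∸ 1)) , (begin
    y ^ᴿ (2 ^ (n ∸ 1)) * y ^ᴿ (2 ^ (n ∸ 1))   ≈⟨ ^-homo-* y (2 ^ (n ∸ 1)) (2 ^ (n ∸ 1)) ⟨
    y ^ᴿ (2 ^ (n ∸ 1) ℕ.+ 2 ^ (n ∸ 1))        ≡⟨ cong (λ k → y ^ᴿ (2 ^ (n ∸ 1) ℕ.+ k)) (ℕ.+-identityʳ _) ⟨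
    y ^ᴿ (2 ^ (1 ℕ.+ (n ∸ 1)))                ≡⟨ cong (λ k → y ^ᴿ (2 ^ k)) (ℕ.m+[n∸m]≡n (ℕ.<⇒≤ 2≤n)) ⟩
    y ^ᴿ (2 ^ n)                              ≈⟨ fermat y ⟩
    y                                         ∎)

  -- The inversion map.

  2<q : 2 < 2 ^ n
  2<q = ℕ.<-≤-trans (s≤s (s≤s (s≤s z≤n))) (ℕ.^-monoʳ-≤ 2 2≤n)

  ψ-cong : ∀ {x y} → x ≈ y → ψ x ≈ ψ y
  ψ-cong = ^-congˡ (2 ^ n ∸ 2)

  ψ-* : ∀ x y → ψ (x * y) ≈ ψ x * ψ y
  ψ-* x y = ^-distrib-* x y (2 ^ n ∸ 2)

  -- The strict bound `2<q` makes the exponent 2^n - 2 positive; exponent 0 would give the value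
  -- `1#` at zero.
  ψ-zero : ∀ {x} → x ≈ 0# → ψ x ≈ 0#
  ψ-zero = x≈0⇒x^k≈0 (ℕ.m<n⇒0<n∸m 2<q)

  -- One more factor x raises the exponent to 2^n, where `fermat` applies; that factor is then
  -- cancelled.
  ψ-inverse : ∀ {x} → x ≉ 0# → x * ψ x ≈ 1#
  ψ-inverse {x} x≉0 = *-cancelˡ x≉0 (begin
    x * (x * ψ x)              ≡⟨⟩
    x ^ᴿ (2 ℕ.+ (2 ^ n ∸ 2))   ≡⟨ cong (x ^ᴿ_) (ℕ.m+[n∸m]≡n (ℕ.<⇒≤ 2<q)) ⟩
    x ^ᴿ (2 ^ n)               ≈⟨ fermat x ⟩
    x                          ≈⟨ *-identityʳ x ⟨
    x * 1#                     ∎)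

  ψ-nonzero : ∀ {x} → x ≉ 0# → ψ x ≉ 0#
  ψ-nonzero x≉0 ψx≈0 = 1≉0 (trans (sym (ψ-inverse x≉0)) (trans (*-congˡ ψx≈0) (zeroʳ _)))

  -- For nonzero x, both `ψ (ψ x)` and x are inverses of `ψ x`.
  ψ-involutive : ∀ x → ψ (ψ x) ≈ x
  ψ-involutive x with x ≟ 0#
  ... | yes x≈0 = trans (ψ-zero (ψ-zero x≈0)) (sym x≈0)
  ... | no  x≉0 = *-cancelˡ (ψ-nonzero x≉0) (trans (ψ-inverse (ψ-nonzero x≉0))
                    (trans (sym (ψ-inverse x≉0)) (*-comm _ _)))

  ψ-injective : ∀ {x y} → ψ x ≈ ψ y → x ≈ y
  ψ-injective eq = trans (sym (ψ-involutive _)) (trans (ψ-cong eq) (ψ-involutive _))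

  -- Treats the points where denominators cannot be cleared: the term `ψ x` drops out, and `ψ` is
  -- injective.
  ψ-sum-zero : ∀ {x y z} → x ≈ 0# → ψ x + ψ y + ψ z ≈ 0# → y ≈ z
  ψ-sum-zero {x} {y} {z} x≈0 eq = ψ-injective (x+y≈0⇒x≈y (begin
    ψ y + ψ z          ≈⟨ +-congʳ (+-identityˡ _) ⟨
    0# + ψ y + ψ z     ≈⟨ +-congʳ (+-congʳ (ψ-zero x≈0)) ⟨
    ψ x + ψ y + ψ z    ≈⟨ eq ⟩
    0#                 ∎))

  ψ-sum-nonzero : ∀ {x y z} → x ≉ 0# → y ≉ 0# → z ≉ 0# →
    x * y * z * (ψ x + ψ y + ψ z) ≈ y * z + x * z + x * y
  ψ-sum-nonzero {x} {y} {z} x≉0 y≉0 z≉0 = begin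
    x * y * z * (ψ x + ψ y + ψ z)
      ≈⟨ solve 6 (λ x y z a b c → x :* y :* z :* (a :+ b :+ c) :=
           (x :* a) :* (y :* z) :+ (y :* b) :* (x :* z) :+ (z :* c) :* (x :* y)) refl x y z _ _ _ ⟩
    (x * ψ x) * (y * z) + (y * ψ y) * (x * z) + (z * ψ z) * (x * y)
      ≈⟨ +-cong (+-cong (one x≉0) (one y≉0)) (one z≉0) ⟩
    y * z + x * z + x * y ∎
    where
    one : ∀ {u v} → u ≉ 0# → (u * ψ u) * v ≈ v
    one u≉0 = trans (*-congʳ (ψ-inverse u≉0)) (*-identityˡ _)

  -- The unique root of the three-term equation.

  module Equation (ρ : Carrier) (ρ≉0 : ρ ≉ 0#) (ρ≉1 : ρ ≉ 1#) where

    g : Carrier → Carrier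
    g τ = ψ τ + ψ (τ + 1#) + ψ (τ + ρ)

    x≈x+y⇒y≈0 : ∀ {x y} → x ≈ x + y → y ≈ 0#
    x≈x+y⇒y≈0 {x} x≈x+y = +-cancelˡ x _ _ (trans (sym x≈x+y) (sym (+-identityʳ x)))

    -- The second elementary symmetric polynomial of τ, τ + 1, τ + ρ is 3τ² + 2(1 + ρ)τ + ρ, and the
    -- even coefficients vanish.
    g-root : ∀ {τ} → τ ≉ 0# → τ + 1# ≉ 0# → τ + ρ ≉ 0# →
      τ * (τ + 1#) * (τ + ρ) * g τ ≈ τ * τ + ρ
    g-root {τ} τ≉0 τ+1≉0 τ+ρ≉0 = trans (ψ-sum-nonzero τ≉0 τ+1≉0 τ+ρ≉0)
      (solve 2 (λ τ ρ → (τ :+ con true) :* (τ :+ ρ) :+ τ :* (τ :+ ρ) :+ τ :* (τ :+ con true)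
                 := τ :* τ :+ ρ) refl τ ρ)

    g≈0⇒τ²≈ρ : ∀ {τ} → g τ ≈ 0# → τ * τ ≈ ρ
    g≈0⇒τ²≈ρ {τ} gτ≈0 = x+y≈0⇒x≈y
      (trans (sym (g-root τ≉0 τ+1≉0 τ+ρ≉0)) (trans (*-congˡ gτ≈0) (zeroʳ _)))
      where
      -- At each excluded point one term vanishes, and equating the arguments of the other two gives
      -- ρ = 1, ρ = 0 or 1 = 0 respectively.
      τ≉0 : τ ≉ 0#
      τ≉0 τ≈0 = ρ≉1 (+-cancelˡ τ _ _ (sym (ψ-sum-zero τ≈0 gτ≈0)))
      τ+1≉0 : τ + 1# ≉ 0#
      τ+1≉0 eq = ρ≉0 (x≈x+y⇒y≈0 (ψ-sum-zero eq
        (trans (+-congʳ (+-comm _ _)) gτ≈0)))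
      τ+ρ≉0 : τ + ρ ≉ 0#
      τ+ρ≉0 eq = 1≉0 (x≈x+y⇒y≈0 (ψ-sum-zero eq
        (trans (trans (+-assoc _ _ _) (+-comm _ _)) gτ≈0)))

    τ²≈ρ⇒g≈0 : ∀ {τ} → τ * τ ≈ ρ → g τ ≈ 0#
    τ²≈ρ⇒g≈0 {τ} ττ≈ρ = *-cancelˡ (*-nonzero (*-nonzero τ≉0 τ+1≉0) τ+ρ≉0)
      (trans (g-root τ≉0 τ+1≉0 τ+ρ≉0) (trans (x≈y⇒x+y≈0 ττ≈ρ) (sym (zeroʳ _))))
      where
      τ≉0 : τ ≉ 0#
      τ≉0 τ≈0 = ρ≉0 (trans (sym ττ≈ρ) (trans (*-congʳ τ≈0) (zeroˡ τ)))
      τ≉1 : τ ≉ 1#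
      τ≉1 τ≈1 = ρ≉1 (trans (sym ττ≈ρ) (trans (*-cong τ≈1 τ≈1) (*-identityˡ 1#)))
      τ+1≉0 : τ + 1# ≉ 0#
      τ+1≉0 = τ≉1 ∘ x+y≈0⇒x≈y
      -- Here τ = ρ would give τ² = τ, hence τ = 1.
      τ+ρ≉0 : τ + ρ ≉ 0#
      τ+ρ≉0 eq = τ≉1 (*-cancelˡ τ≉0 (trans ττ≈ρ (trans (sym (x+y≈0⇒x≈y eq)) (sym (*-identityʳ τ)))))

    τ₀ : Carrier
    τ₀ = proj₁ (square-surjective ρ)

    i₀ : Fin (2 ^ n)
    i₀ = index τ₀

    g-element-i₀ : g (element i₀) ≈ 0#
    g-element-i₀ = τ²≈ρ⇒g≈0 (trans (*-cong (element-index τ₀) (element-index τ₀)) (proj₂ (square-surjective ρ)))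

    g-element-unique : ∀ j → g (element j) ≈ 0# → j ≡ i₀
    g-element-unique j eq = index-unique (square-injective
      (trans (g≈0⇒τ²≈ρ eq) (sym (proj₂ (square-surjective ρ)))))

    rootCount : ∣ (λ τ → g τ ≟ 0#) ∣ ≡ 1
    rootCount = length-filter-unique (λ τ → g τ ≟ 0#) element i₀ g-element-i₀ g-element-unique

  -- The trace maps onto the prime field.

  Tr-cong : ∀ {x y} → x ≈ y → Tr x ≈ Tr y
  Tr-cong = trace-cong n

  Tr-+ : ∀ x y → Tr (x + y) ≈ Tr x + Tr y
  Tr-+ = trace-+ square-+ n

  -- The square of the trace is the trace of x². Squaring shifts the n terms cyclically, because the
  -- new last term x^(2^n) is x again; adding x to both sides exposes this.
  Tr-idempotent : ∀ x → Tr x * Tr x ≈ Tr x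
  Tr-idempotent x = +-cancelˡ x _ _ (begin
    x + Tr x * Tr x         ≈⟨ +-congˡ (trace-square square-+ n x) ⟨
    x + Tr (x * x)          ≈⟨ trace-suc n x ⟨
    trace (suc n) x         ≈⟨ trace-last n x ⟩
    Tr x + x ^ᴿ (2 ^ n)     ≈⟨ +-congˡ (fermat x) ⟩
    Tr x + x                ≈⟨ +-comm _ _ ⟩
    x + Tr x                ∎)

  Tr-nonzero⇒one : ∀ {x} → Tr x ≉ 0# → Tr x ≈ 1#
  Tr-nonzero⇒one {x} Tr≉0 = *-cancelˡ Tr≉0 (trans (Tr-idempotent x) (sym (*-identityʳ _)))

  -- The trace is a polynomial of degree 2^(n-1) < 2^n.
  Tr-surjective : ∃ λ u → Tr u ≈ 1#
  Tr-surjective with any? (λ i → ¬? (Tr (element i) ≟ 0#))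
  ... | yes (i , Tr≉0) = element i , Tr-nonzero⇒one Tr≉0
  ... | no  none       = contradiction
    (roots≤degree 1≉0 cancel polynomial element element-injective root) (ℕ.<⇒≱ degree<q)
    where
    n≡ : 1 ℕ.+ (n ∸ 1) ≡ n
    n≡ = ℕ.m+[n∸m]≡n (ℕ.<⇒≤ 2≤n)
    polynomial : List Carrier
    polynomial = proj₁ (tracePolynomial (n ∸ 1))
    degree<q : length polynomial < 2 ^ n
    degree<q = ≡.subst (_< 2 ^ n) (≡.sym (proj₁ (proj₂ (tracePolynomial (n ∸ 1)))))
      (ℕ.^-monoʳ-< 2 (s≤s (s≤s z≤n)) (ℕ.≤-reflexive n≡))
    root : ∀ i → eval polynomial (element i) ≈ 0#
    root i = begin
      eval polynomial (element i)         ≈⟨ proj₂ (proj₂ (tracePolynomial (n ∸ 1))) (element i) ⟩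
      trace (1 ℕ.+ (n ∸ 1)) (element i)   ≡⟨ cong (λ m → trace m (element i)) n≡ ⟩
      Tr (element i)                      ≈⟨ decidable-stable (_ ≟ _) (λ Tr≉0 → none (i , Tr≉0)) ⟩
      0#                                  ∎
    element-injective : ∀ {i j} → element i ≈ element j → i ≡ j
    element-injective eq = ≡.trans (index-unique eq) (index-element _)
    cancel : ∀ {x y z} → x ≉ y → x * z ≈ y * z → z ≈ 0#
    cancel x≉y xz≈yz = decidable-stable (_ ≟ _) (λ z≉0 →
      x≉y (*-cancelˡ z≉0 (trans (*-comm _ _) (trans xz≈yz (*-comm _ _)))))

  -- The additive character.

  exponent-zero : ∀ {y} → y ≈ 0# → exponent y ≡ 0
  exponent-zero {y} y≈0 rewrite dec-true (y ≟ 0#) y≈0 = ≡.refl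

  exponent-nonzero : ∀ {y} → y ≉ 0# → exponent y ≡ 1
  exponent-nonzero {y} y≉0 rewrite dec-false (y ≟ 0#) y≉0 = ≡.refl

  exponent-cong : ∀ {x y} → x ≈ y → exponent x ≡ exponent y
  exponent-cong {x} {y} x≈y with x ≟ 0#
  ... | yes x≈0 = ≡.trans (exponent-zero x≈0) (≡.sym (exponent-zero (trans (sym x≈y) x≈0)))
  ... | no  x≉0 = ≡.trans (exponent-nonzero x≉0) (≡.sym (exponent-nonzero (x≉0 ∘ trans x≈y)))

  χ-cong : ∀ {x y} → x ≈ y → χ x ≡ χ y
  χ-cong x≈y = cong (-1ℤ ℤ.^_) (exponent-cong (Tr-cong x≈y))

  χ-kernel : ∀ {x} → Tr x ≈ 0# → χ x ≡ 1ℤ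
  χ-kernel Tr≈0 = cong (-1ℤ ℤ.^_) (exponent-zero Tr≈0)

  χ-nonkernel : ∀ {x} → Tr x ≈ 1# → χ x ≡ -1ℤ
  χ-nonkernel Tr≈1 = cong (-1ℤ ℤ.^_) (exponent-nonzero (λ Tr≈0 → 1≉0 (trans (sym Tr≈1) Tr≈0)))

  Tr-zero : ∀ {x} → x ≈ 0# → Tr x ≈ 0#
  Tr-zero {x} x≈0 = +-cancelˡ (Tr x) _ _ (begin
    Tr x + Tr x ≈⟨ Tr-+ x x ⟨
    Tr (x + x)  ≈⟨ Tr-cong (trans (+-congˡ x≈0) (+-identityʳ x)) ⟩
    Tr x        ≈⟨ +-identityʳ _ ⟨
    Tr x + 0#   ∎)

  -- Adding an element of trace one switches the trace between `0#` and `1#`, so the two signs are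
  -- opposite.
  χ-shift : ∀ {u} → Tr u ≈ 1# → ∀ x → χ x ℤ.+ χ (x + u) ≡ 0ℤ
  χ-shift {u} Tru≈1 x with Tr x ≟ 0#
  ... | yes Tr≈0 = cong₂ ℤ._+_ (χ-kernel Tr≈0)
          (χ-nonkernel (trans (Tr-+ x u) (trans (+-cong Tr≈0 Tru≈1) (+-identityˡ 1#))))
  ... | no  Tr≉0 = cong₂ ℤ._+_ (χ-nonkernel (Tr-nonzero⇒one Tr≉0))
          (χ-kernel (trans (Tr-+ x u) (trans (+-cong (Tr-nonzero⇒one Tr≉0) Tru≈1) characteristic2)))

  -- Vanishing of complete character sums.

  open Sum ℤ.+-0-commutativeMonoid using (sum-cong-≗; ∑-distrib-+; ∑-comm; sum-replicate-zero)

  ∑-cong : ∀ {f h} → (∀ x → f x ≡ h x) → ∑ f ≡ ∑ h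
  ∑-cong f≗h = sum-cong-≗ (λ i → f≗h (element i))

  ∑-reindex : ∀ (h : Carrier → ℤ) → (∀ {x y} → x ≈ y → h x ≡ h y) →
    ∀ f g → Congruent₁ _≈_ f → Congruent₁ _≈_ g →
    (∀ x → f (g x) ≈ x) → (∀ x → g (f x) ≈ x) → ∑ h ≡ ∑ (h ∘ f)
  ∑-reindex = sum-reindex ℤ.+-0-commutativeMonoid

  -- Translating by an element u of trace one leaves the sum unchanged, so twice the sum is made of
  -- the cancelling pairs of `χ-shift`.
  ∑χ≡0 : ∑ χ ≡ 0ℤ
  ∑χ≡0 with Tr-surjective
  ... | u , Tru≈1 = i+i≡0⇒i≡0 (∑ χ) (≡R.begin
    ∑ χ ℤ.+ ∑ χ                 ≡R.≡⟨ cong (ℤ._+_ (∑ χ)) (∑-reindex χ χ-cong (_+ u) (_+ u)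
                                        +-congʳ +-congʳ cancel cancel) ⟩
    ∑ χ ℤ.+ ∑ (λ x → χ (x + u)) ≡R.≡⟨ ∑-distrib-+ (χ ∘ element) _ ⟨
    ∑ (λ x → χ x ℤ.+ χ (x + u)) ≡R.≡⟨ ∑-cong (χ-shift Tru≈1) ⟩
    ∑ (λ _ → 0ℤ)                ≡R.≡⟨ sum-replicate-zero (2 ^ n) ⟩
    0ℤ                          ≡R.∎)
    where
    module ≡R = ≡-Reasoning
    -- In characteristic 2 the translation by u is its own inverse.
    cancel : ∀ x → x + u + u ≈ x
    cancel x = solve 2 (λ x u → x :+ u :+ u := x) refl x u

  ∑χ-scaled≡0 : ∀ {b} → b ≉ 0# → ∑ (λ x → χ (x * b)) ≡ 0ℤ
  ∑χ-scaled≡0 {b} b≉0 with inverse b≉0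
  ... | b⁻¹ , bb⁻¹≈1 = ≡.trans
    (≡.sym (∑-reindex χ χ-cong (_* b) (_* b⁻¹) *-congʳ *-congʳ
      (inverse-undoʳ (trans (*-comm b⁻¹ b) bb⁻¹≈1)) (inverse-undoʳ bb⁻¹≈1)))
    ∑χ≡0

  ∑χψ-scaled≡0 : ∀ {b} → b ≉ 0# → ∑ (λ x → χ (ψ x * b)) ≡ 0ℤ
  ∑χψ-scaled≡0 {b} b≉0 = ≡.trans
    (≡.sym (∑-reindex (λ x → χ (x * b)) (χ-cong ∘ *-congʳ) ψ ψ ψ-cong ψ-cong ψ-involutive ψ-involutive))
    (∑χ-scaled≡0 b≉0)

  χ-zero : ∀ {x} → x ≈ 0# → χ x ≡ 1ℤ
  χ-zero x≈0 = χ-kernel (Tr-zero x≈0)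

  -- The double character sum.

  module CharacterSum (ρ : Carrier) (ρ≉0 : ρ ≉ 0#) (ρ≉1 : ρ ≉ 1#) where
    open Equation ρ ρ≉0 ρ≉1

    -- The number of elements, kept as a sum of ones: both contributions arise in this shape and are
    -- cancelled against each other.
    q : ℤ
    q = ∑ (λ _ → 1ℤ)

    G : Carrier → Carrier → Carrier
    G t a = ψ (t + ρ * a) + ψ (t + a) + ψ t

    column : Carrier → ℤ
    column a = ∑ (λ t → χ (G t a))

    -- What `column a` becomes under t = aτ when a is nonzero. It is defined at a = 0 as well, where
    -- it is q while the column sum is 0, so that it can be summed over all a.
    factored : Carrier → ℤ
    factored a = ∑ (λ τ → χ (ψ a * g τ))

    G-cong : ∀ {t t′ a a′} → t ≈ t′ → a ≈ a′ → G t a ≈ G t′ a′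
    G-cong t≈t′ a≈a′ = +-cong (+-cong (ψ-cong (+-cong t≈t′ (*-congˡ a≈a′)))
      (ψ-cong (+-cong t≈t′ a≈a′))) (ψ-cong t≈t′)

    -- All three arguments are multiples of a, and `ψ` is multiplicative.
    G-homogeneous : ∀ a τ → G (a * τ) a ≈ ψ a * g τ
    G-homogeneous a τ = begin
      ψ (a * τ + ρ * a) + ψ (a * τ + a) + ψ (a * τ)
        ≈⟨ +-congʳ (+-cong
             (ψ-cong (solve 3 (λ a τ ρ → a :* τ :+ ρ :* a := a :* (τ :+ ρ)) refl a τ ρ))
             (ψ-cong (solve 2 (λ a τ → a :* τ :+ a := a :* (τ :+ con true)) refl a τ))) ⟩
      ψ (a * (τ + ρ)) + ψ (a * (τ + 1#)) + ψ (a * τ)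
        ≈⟨ +-cong (+-cong (ψ-* a _) (ψ-* a _)) (ψ-* a τ) ⟩
      ψ a * ψ (τ + ρ) + ψ a * ψ (τ + 1#) + ψ a * ψ τ
        ≈⟨ solve 4 (λ a x y z → a :* x :+ a :* y :+ a :* z := a :* (z :+ y :+ x)) refl _ _ _ _ ⟩
      ψ a * g τ ∎

    column-nonzero : ∀ {a} → a ≉ 0# → column a ≡ factored a
    column-nonzero {a} a≉0 with inverse a≉0
    ... | a⁻¹ , aa⁻¹≈1 = ≡.trans
      (∑-reindex (λ t → χ (G t a)) (λ t≈t′ → χ-cong (G-cong t≈t′ refl)) (a *_) (a⁻¹ *_) *-congˡ *-congˡ
        (inverse-undoˡ aa⁻¹≈1) (inverse-undoˡ (trans (*-comm a⁻¹ a) aa⁻¹≈1)))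
      (∑-cong (λ τ → χ-cong (G-homogeneous a τ)))

    column-zero : ∀ {a} → a ≈ 0# → column a ≡ 0ℤ
    column-zero {a} a≈0 = ≡.trans (∑-cong (λ t → χ-cong (G-zero t))) (∑χψ-scaled≡0 1≉0)
      where
      -- Three equal terms reduce to one; the factor `1#` matches the form of `∑χψ-scaled≡0`.
      G-zero : ∀ t → G t a ≈ ψ t * 1#
      G-zero t = begin
        ψ (t + ρ * a) + ψ (t + a) + ψ t
          ≈⟨ +-congʳ (+-cong
               (ψ-cong (trans (+-congˡ (trans (*-congˡ a≈0) (zeroʳ ρ))) (+-identityʳ t)))
               (ψ-cong (trans (+-congˡ a≈0) (+-identityʳ t)))) ⟩
        ψ t + ψ t + ψ t
          ≈⟨ solve 1 (λ y → y :+ y :+ y := y :* con true) refl (ψ t) ⟩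
        ψ t * 1# ∎

    factored-zero : ∀ {a} → a ≈ 0# → factored a ≡ q
    factored-zero a≈0 = ∑-cong (λ τ → χ-zero (trans (*-congʳ (ψ-zero a≈0)) (zeroˡ (g τ))))

    -- With the sum over a taken inside, `∑χψ-scaled≡0` kills every τ with g(τ) nonzero, and the
    -- unique root contributes a sum of ones.
    ∑factored≡q : ∑ factored ≡ q
    ∑factored≡q = ≡.trans (∑-comm (λ i j → χ (ψ (element i) * g (element j))))
      (≡.trans
        (sum-single ℤ.+-0-commutativeMonoid (λ j → ∑ (λ a → χ (ψ a * g (element j)))) i₀
          (λ j j≢i₀ → ∑χψ-scaled≡0 (j≢i₀ ∘ g-element-unique j)))
        (∑-cong (λ a → χ-zero (trans (*-congˡ g-element-i₀) (zeroʳ (ψ a))))))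

    -- `column` and `factored` differ only at a = 0, so exchanging those two values gives q +
    -- `∑ column` = 0 + q.
    ∑column≡0 : ∑ column ≡ 0ℤ
    ∑column≡0 = ℤ+.∙-cancelˡ q _ _ (≡R.begin
      q ℤ.+ ∑ column                       ≡R.≡⟨ cong (ℤ._+ ∑ column) (factored-zero (element-index 0#)) ⟨
      factored (element z) ℤ.+ ∑ column    ≡R.≡⟨ sum-differ-at ℤ.+-0-commutativeMonoid
                                                   (column ∘ element) (factored ∘ element) z
                                                   (λ j j≢z → column-nonzero (j≢z ∘ index-unique)) ⟩
      column (element z) ℤ.+ ∑ factored    ≡R.≡⟨ cong₂ ℤ._+_ (column-zero (element-index 0#)) ∑factored≡q ⟩
      0ℤ ℤ.+ q                             ≡R.≡⟨ ℤ.+-comm 0ℤ q ⟩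
      q ℤ.+ 0ℤ                             ≡R.∎)
      where
      module ≡R = ≡-Reasoning
      module ℤ+ = GroupProperties (AbelianGroup.group ℤ.+-0-abelianGroup)
      z : Fin (2 ^ n)
      z = index 0#

    characterSum : ∑ (λ t → ∑ (λ a → χ (G t a))) ≡ 0ℤ
    characterSum = ≡.trans (∑-comm (λ i j → χ (G (element i) (element j)))) ∑column≡0

theorem9p3 : {c ℓ₁ ℓ₂ : Level} (n : ℕ) → 2 ≤ n →
    (F : HeytingField c ℓ₁ ℓ₂) →
    (card : HasCardinality (CommutativeRing.setoid (ringOf F)) (2 ^ n)) →
    let open BinaryField n F card in
    ((ρ : Carrier) → ρ ≉ 0# → ρ ≉ 1# →
    ∣ (λ τ → (ψ τ + ψ (τ + 1#) + ψ (τ + ρ)) ≟ 0#) ∣ ≡ 1)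
    ×
    ((ρ : Carrier) → ρ ≉ 0# → ρ ≉ 1# →
    ∑ (λ t → ∑ (λ a → χ (ψ (t + ρ * a) + ψ (t + a) + ψ t))) ≡ 0ℤ)
theorem9p3 n 2≤n F card = Equation.rootCount , CharacterSum.characterSum
  where open FiniteField n 2≤n F card
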